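{- Let $a_n$ denote the number of complete rulers of length $n$, i.e. the number of subsets $R \subseteq \{0,1,\dots,n\}$ such that $\{0,1,\dots,n\} \subseteq R-R$. Then there is a constant $c$ with $0.2433 < c < 0.2451$ such that $a_n \sim c\cdot 2^n$ as $n\to\infty$ (i.e. $a_n/2^n \to c$).
   Context: For a set $R$ of integers, $R-R := \{x-y : x,y\in R\}$. A ruler of length $L$ is any subset $R \subseteq \{0,\dots,L\}$; it is complete if $\{0,\dots,L\}\subseteq R-R$. (This is OEIS sequence A103295.) -}

module Defs where

open import Data.Nat using (ℕ; zero; suc; _+_; _^_; _≥_)
open import Data.Nat.Properties using (_≟_; m^n≢0)
open import Data.List using (List; []; _∷_; map; _++_; upTo; filter; length)
open import Data.List.Relation.Unary.All using (All; all?)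
open import Data.List.Relation.Unary.Any using (Any; any?)
open import Data.List.Membership.Propositional using (_∈_)
open import Data.List.Membership.DecPropositional _≟_ using (_∈?_)
open import Data.Integer using (+_)
open import Data.Rational using (ℚ; _/_; _-_; ∣_∣; _<_; _≤_; 0ℚ)
open import Data.Product using (Σ; ∃; _×_)
open import Relation.Nullary using (Dec)

sublists : List ℕ → List (List ℕ)
sublists []       = [] ∷ []
sublists (x ∷ xs) = sublists xs ++ map (x ∷_) (sublists xs)

rulers : ℕ → List (List ℕ)
rulers n = sublists (upTo (suc n))

-- R is complete of length n: every d ∈ {0,…,n} lies in R - R,
-- i.e. there are x,y ∈ R with x - y = d (equivalently x = y + d).
Complete : ℕ → List ℕ → Set
Complete n R = All (λ d → Any (λ y → (y + d) ∈ R) R) (upTo (suc n))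

complete? : ∀ n R → Dec (Complete n R)
complete? n R = all? (λ d → any? (λ y → (y + d) ∈? R) R) (upTo (suc n))

a : ℕ → ℕ
a n = length (filter (complete? n) (rulers n))

ratio : ℕ → ℚ
ratio n = _/_ (+ a n) (2 ^ n) {{m^n≢0 2 n}}

-- Real-number limit encoded without reals: the sequence is Cauchy
-- (with witnesses for every positive rational ε) ...
Cauchy : (ℕ → ℚ) → Set
Cauchy f = (ε : ℚ) → 0ℚ < ε → ∃ λ N → ∀ m n → m ≥ N → n ≥ N → ∣ f m - f n ∣ < ε

-- ... and its limit c satisfies lo < c : some rational q > lo eventually
-- bounds the sequence from below.
LimitAbove : (ℕ → ℚ) → ℚ → Set
LimitAbove f lo = Σ ℚ λ q → lo < q × ∃ λ N → ∀ n → n ≥ N → q ≤ f n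

-- c < hi : some rational q < hi eventually bounds the sequence from above.
LimitBelow : (ℕ → ℚ) → ℚ → Set
LimitBelow f hi = Σ ℚ λ q → q < hi × ∃ λ N → ∀ n → n ≥ N → f n ≤ q

{-# OPTIONS --safe #-}

-- A difference n − k with k small involves only the first and the last k + 1
-- elements of a ruler, which are independent.  So 2ⁿ⁺¹ V h / 4ʰ counts the
-- rulers having the differences n − k for all k < h, where V h / 4ʰ is the
-- probability that two independent random subsets A, B of {0,…,h−1} satisfy
-- {0,…,h−1} ⊆ A + B.  The pairs at distance d = n + 1 − e contain at least e/2
-- disjoint ones, hence d is missing with probability at most (3/4)^⌊e/2⌋, and
-- the differences ignored by V h together cost O((3/4)^(h/2)), uniformly in n.
--
-- For the numerical bounds, V 16 is computed exactly: run over all pairs of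
-- subsets of {0,…,7}, and treat the sums 8,…,15 by inclusion–exclusion, since
-- given the pair each of them is missed iff certain free bits all vanish.
-- Given a pair of sizes p, q, the sum k ≥ 16 is missed with probability
-- 2^(−p−q) (3/4)^(k−15); subtracting these from V 16 / 4¹⁶ for all pairs that
-- hit 0,…,7 bounds V h / 4ʰ from below for every h ≥ 16.
module Submission where

open import Defs
open import Algebra.Properties.AbelianGroup using (xyx⁻¹≈y; ⁻¹-anti-homo‿-)
open import Data.Bool using (Bool; true; false; T; not; if_then_else_; _∧_; _∨_)
open import Data.Bool.Properties
  using (T?; T-∧; ∧-assoc; ∧-comm; ∧-identityʳ; ∨-assoc; ∨-comm; ∨-identityʳ)
open import Data.Integer using (+_)
import Data.Integer as ℤ
import Data.Integer.Properties as ℤ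
open import Data.List using
  (List; []; _∷_; _++_; length; drop; take; replicate; map; filter; upTo; applyUpTo)
open import Data.List.Membership.Propositional using (_∈_; find; lose)
open import Data.List.Properties using
  (length-++; length-drop; length-take; length-replicate; length-applyUpTo; filter-++; take++drop≡id; ++-assoc)
open import Data.List.Relation.Unary.All.Properties using (applyUpTo⁺₁; applyUpTo⁻)
open import Data.List.Relation.Unary.Any using (here; there)
open import Data.Nat hiding (_/_)
open import Data.Nat.Properties
open import Data.Nat.Tactic.RingSolver using (solve-∀)
open import Data.Product using (_×_; _,_; ∃; map₂)
open import Data.Rational using (ℚ; mkℚ; 0ℚ; toℚᵘ; _/_)
import Data.Rational as ℚ
import Data.Rational.Properties as ℚ
open import Data.Rational.Unnormalised using (mkℚᵘ)
import Data.Rational.Unnormalised as ℚᵘ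
import Data.Rational.Unnormalised.Properties as ℚᵘ
open import Data.Sum using (inj₁; inj₂)
open import Data.Unit using (tt)
open import Function using (_∘_; id; _⇔_; mk⇔; Equivalence)
open import Relation.Binary.PropositionalEquality
open import Relation.Nullary using (does)
open import Relation.Nullary.Decidable using (does-⇔)
open import Relation.Unary using (Decidable)

-- Summation over all subsets.

-- A subset of {0,…,n−1} is encoded by its indicator list of length n, and S n
-- sums over all of them.
S : ℕ → (List Bool → ℕ) → ℕ
S zero    F = F []
S (suc n) F = S n (F ∘ (false ∷_)) + S n (F ∘ (true ∷_))

S-mono : ∀ n {F G} → (∀ r → length r ≡ n → F r ≤ G r) → S n F ≤ S n G
S-mono zero    h = h [] refl
S-mono (suc n) h = +-mono-≤ (S-mono n λ r p → h (false ∷ r) (cong suc p))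
                            (S-mono n λ r p → h (true ∷ r) (cong suc p))

S-cong : ∀ n {F G} → (∀ r → length r ≡ n → F r ≡ G r) → S n F ≡ S n G
S-cong zero    h = h [] refl
S-cong (suc n) h = cong₂ _+_ (S-cong n λ r p → h (false ∷ r) (cong suc p))
                             (S-cong n λ r p → h (true ∷ r) (cong suc p))

interchange : ∀ a b c d → (a + b) + (c + d) ≡ (a + c) + (b + d)
interchange = solve-∀

S-+ : ∀ n F G → S n (λ r → F r + G r) ≡ S n F + S n G
S-+ zero    F G = refl
S-+ (suc n) F G = trans
  (cong₂ _+_ (S-+ n (F ∘ (false ∷_)) (G ∘ (false ∷_))) (S-+ n (F ∘ (true ∷_)) (G ∘ (true ∷_))))
  (interchange (S n (F ∘ (false ∷_))) (S n (G ∘ (false ∷_))) (S n (F ∘ (true ∷_))) (S n (G ∘ (true ∷_))))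

S-*ˡ : ∀ n c F → S n (λ r → c * F r) ≡ c * S n F
S-*ˡ zero    c F = refl
S-*ˡ (suc n) c F = trans
  (cong₂ _+_ (S-*ˡ n c (F ∘ (false ∷_))) (S-*ˡ n c (F ∘ (true ∷_))))
  (sym (*-distribˡ-+ c (S n (F ∘ (false ∷_))) (S n (F ∘ (true ∷_)))))

S-*ʳ : ∀ n c F → S n (λ r → F r * c) ≡ S n F * c
S-*ʳ n c F = trans (S-cong n λ r _ → *-comm (F r) c) (trans (S-*ˡ n c F) (*-comm c (S n F)))

S-const : ∀ n c → S n (λ _ → c) ≡ 2 ^ n * c
S-const zero    c = sym (+-identityʳ c)
S-const (suc n) c = trans (cong₂ _+_ (S-const n c) (S-const n c)) (lem (2 ^ n) c)
  where
  lem : ∀ x c → x * c + x * c ≡ 2 * x * c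
  lem = solve-∀

S-++ : ∀ m n F → S (m + n) F ≡ S m λ u → S n λ v → F (u ++ v)
S-++ zero    n F = refl
S-++ (suc m) n F = cong₂ _+_ (S-++ m n (F ∘ (false ∷_))) (S-++ m n (F ∘ (true ∷_)))

S-swap : ∀ m n (F : List Bool → List Bool → ℕ) →
         S m (λ u → S n (λ v → F u v)) ≡ S n (λ v → S m (λ u → F u v))
S-swap zero    n F = refl
S-swap (suc m) n F = trans
  (cong₂ _+_ (S-swap m n (F ∘ (false ∷_))) (S-swap m n (F ∘ (true ∷_))))
  (sym (S-+ n (λ v → S m (λ u → F (false ∷ u) v)) (λ v → S m (λ u → F (true ∷ u) v))))

-- Common positions of two indicator lists.

𝟙 : Bool → ℕ
𝟙 b = if b then 1 else 0

meet : List Bool → List Bool → Bool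
meet []          _           = false
meet (_ ∷ _)     []          = false
meet (false ∷ u) (_ ∷ v)     = meet u v
meet (true ∷ u)  (false ∷ v) = meet u v
meet (true ∷ u)  (true ∷ v)  = true

meet-[]ʳ : ∀ u → meet u [] ≡ false
meet-[]ʳ []      = refl
meet-[]ʳ (_ ∷ _) = refl

meet-comm : ∀ u v → meet u v ≡ meet v u
meet-comm []          v           = sym (meet-[]ʳ v)
meet-comm (_ ∷ _)     []          = refl
meet-comm (false ∷ u) (false ∷ v) = meet-comm u v
meet-comm (false ∷ u) (true ∷ v)  = meet-comm u v
meet-comm (true ∷ u)  (false ∷ v) = meet-comm u v
meet-comm (true ∷ u)  (true ∷ v)  = refl

meet-++ˡ : ∀ u u′ v → meet (u ++ u′) v ≡ meet u v ∨ meet u′ (drop (length u) v)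
meet-++ˡ []          u′ v           = refl
meet-++ˡ (_ ∷ u)     u′ []          = sym (meet-[]ʳ u′)
meet-++ˡ (false ∷ u) u′ (_ ∷ v)     = meet-++ˡ u u′ v
meet-++ˡ (true ∷ u)  u′ (false ∷ v) = meet-++ˡ u u′ v
meet-++ˡ (true ∷ u)  u′ (true ∷ v)  = refl

meet-++ʳ : ∀ u v v′ → meet u (v ++ v′) ≡ meet u v ∨ meet (drop (length v) u) v′
meet-++ʳ u v v′ = begin
  meet u (v ++ v′)                        ≡⟨ meet-comm u (v ++ v′) ⟩
  meet (v ++ v′) u                        ≡⟨ meet-++ˡ v v′ u ⟩
  meet v u ∨ meet v′ (drop (length v) u)  ≡⟨ cong₂ _∨_ (meet-comm v u) (meet-comm v′ _) ⟩
  meet u v ∨ meet (drop (length v) u) v′  ∎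
  where open ≡-Reasoning

drop-++ : ∀ {n} (u v : List Bool) → length u ≡ n → drop n (u ++ v) ≡ v
drop-++ []      v refl = refl
drop-++ (x ∷ u) v refl = drop-++ u v refl

drop-++-≤ : ∀ n (u v : List Bool) → n ≤ length u → drop n (u ++ v) ≡ drop n u ++ v
drop-++-≤ zero    u       v _         = refl
drop-++-≤ (suc n) (x ∷ u) v (s≤s n≤u) = drop-++-≤ n u v n≤u

drop-all : ∀ n (u : List Bool) → length u ≤ n → drop n u ≡ []
drop-all zero    []      _         = refl
drop-all (suc n) []      _         = refl
drop-all (suc n) (x ∷ u) (s≤s u≤n) = drop-all n u u≤n

meet-++ : ∀ u u′ v v′ → length u ≡ length v → meet (u ++ u′) (v ++ v′) ≡ meet u v ∨ meet u′ v′
meet-++ u u′ v v′ eq = begin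
  meet (u ++ u′) (v ++ v′)
    ≡⟨ meet-++ˡ u u′ (v ++ v′) ⟩
  meet u (v ++ v′) ∨ meet u′ (drop (length u) (v ++ v′))
    ≡⟨ cong₂ _∨_ (meet-++ʳ u v v′) (cong (meet u′) (drop-++ v v′ (sym eq))) ⟩
  (meet u v ∨ meet (drop (length v) u) v′) ∨ meet u′ v′
    ≡⟨ cong (λ x → (meet u v ∨ meet x v′) ∨ meet u′ v′) (drop-all _ u (≤-reflexive eq)) ⟩
  (meet u v ∨ false) ∨ meet u′ v′
    ≡⟨ cong (_∨ meet u′ v′) (∨-identityʳ (meet u v)) ⟩
  meet u v ∨ meet u′ v′ ∎
  where open ≡-Reasoning

miss : List Bool → List Bool → ℕ
miss u v = 𝟙 (not (meet u v))

𝟙-not-∨ : ∀ a b → 𝟙 (not (a ∨ b)) ≡ 𝟙 (not a) * 𝟙 (not b)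
𝟙-not-∨ true  b = refl
𝟙-not-∨ false b = sym (+-identityʳ _)

miss≤1 : ∀ u v → miss u v ≤ 1
miss≤1 u v with meet u v
... | true  = z≤n
... | false = s≤s z≤n

miss-++ : ∀ u u′ v v′ → length u ≡ length v → miss (u ++ u′) (v ++ v′) ≡ miss u v * miss u′ v′
miss-++ u u′ v v′ eq = trans (cong (𝟙 ∘ not) (meet-++ u u′ v v′ eq)) (𝟙-not-∨ (meet u v) (meet u′ v′))

-- Two to the number of positions below `n` not occupied by `u`, those past its end included: a list
-- of length `n` misses `u` iff it vanishes at the occupied positions, and its other bits are free.
w : ℕ → List Bool → ℕ
w zero    _           = 1
w (suc n) []          = 2 ^ suc n
w (suc n) (false ∷ u) = 2 * w n u
w (suc n) (true ∷ u)  = w n u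

S-miss : ∀ n u → S n (miss u) ≡ w n u
S-miss zero    u           = cong (𝟙 ∘ not) (meet-[]ʳ u)
S-miss (suc n) []          = trans (S-const (suc n) 1) (*-identityʳ _)
S-miss (suc n) (false ∷ u) = trans (cong₂ _+_ (S-miss n u) (S-miss n u)) (cong (_+_ (w n u)) (sym (+-identityʳ _)))
S-miss (suc n) (true ∷ u)  = trans (cong₂ _+_ (S-miss n u) (trans (S-const n 0) (*-zeroʳ (2 ^ n)))) (+-identityʳ _)

S-w : ∀ n → S n (w n) ≡ 3 ^ n
S-w zero    = refl
S-w (suc n) = trans (cong (_+ S n (w n)) (S-*ˡ n 2 (w n)))
                    (trans (lem (S n (w n))) (cong (3 *_) (S-w n)))
  where
  lem : ∀ x → 2 * x + x ≡ 3 * x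
  lem = solve-∀

-- Each position independently admits three of the four pairs of bits. All factors 3/4 stem from
-- here.
S-S-miss : ∀ n → S n (λ u → S n (miss u)) ≡ 3 ^ n
S-S-miss n = trans (S-cong n λ u _ → S-miss n u) (S-w n)

-- Rulers without a given difference.

-- Dropping `d` entries shifts the set down by `d`, so a common position `y` of `r` and `drop d r`
-- is a pair `y`, `y + d` in the set.
missing : ℕ → ℕ → ℕ
missing N d = S N λ r → miss r (drop d r)

missing-0 : ∀ N → missing N 0 ≡ 1
missing-0 zero    = refl
missing-0 (suc N) = trans (cong₂ _+_ (missing-0 N) (trans (S-const N 0) (*-zeroʳ (2 ^ N)))) refl

-- The pairs (i , i + d) with i < f are disjoint as long as f ≤ d.
missing-≤ : ∀ f g h → missing (f + (g + (f + h))) (f + g) ≤ 3 ^ f * (2 ^ g * 2 ^ h)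
missing-≤ f g h = begin
  missing (f + (g + (f + h))) (f + g)
    ≡⟨ S-++ f _ _ ⟩
  S f (λ p → S (g + (f + h)) λ r → M (p ++ r))
    ≡⟨ S-cong f (λ p _ → trans (S-++ g _ _) (S-cong g λ x _ → S-++ f h _)) ⟩
  S f (λ p → S g λ x → S f λ q → S h λ y → M (p ++ (x ++ (q ++ y))))
    ≤⟨ S-mono f (λ p ∣p∣ → S-mono g λ x ∣x∣ → S-mono f λ q ∣q∣ → S-mono h λ y _ → step p x q y ∣p∣ ∣x∣ ∣q∣) ⟩
  S f (λ p → S g λ x → S f λ q → S h λ y → miss p q)
    ≡⟨ S-cong f (λ p _ → trans (S-const g _) (cong (2 ^ g *_)
        (trans (S-cong f λ q _ → S-const h (miss p q)) (S-*ˡ f (2 ^ h) (miss p))))) ⟩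
  S f (λ p → 2 ^ g * (2 ^ h * S f (miss p)))
    ≡⟨ trans (S-*ˡ f (2 ^ g) _) (cong (2 ^ g *_) (trans (S-*ˡ f (2 ^ h) _) (cong (2 ^ h *_) (S-S-miss f)))) ⟩
  2 ^ g * (2 ^ h * 3 ^ f)
    ≡⟨ lem (2 ^ g) (2 ^ h) (3 ^ f) ⟩
  3 ^ f * (2 ^ g * 2 ^ h) ∎
  where
  open ≤-Reasoning
  M : List Bool → ℕ
  M r = miss r (drop (f + g) r)
  lem : ∀ a b c → a * (b * c) ≡ c * (a * b)
  lem = solve-∀
  step : ∀ p x q y → length p ≡ f → length x ≡ g → length q ≡ f → M (p ++ (x ++ (q ++ y))) ≤ miss p q
  step p x q y ∣p∣ ∣x∣ ∣q∣ = begin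
    M (p ++ (x ++ (q ++ y)))
      ≡⟨ cong (miss (p ++ (x ++ (q ++ y)))) (trans (cong (drop (f + g)) (sym (++-assoc p x (q ++ y))))
           (drop-++ (p ++ x) (q ++ y) (trans (length-++ p) (cong₂ _+_ ∣p∣ ∣x∣)))) ⟩
    miss (p ++ (x ++ (q ++ y))) (q ++ y)
      ≡⟨ miss-++ p _ q y (trans ∣p∣ (sym ∣q∣)) ⟩
    miss p q * miss (x ++ (q ++ y)) y
      ≤⟨ *-monoʳ-≤ (miss p q) (miss≤1 (x ++ (q ++ y)) y) ⟩
    miss p q * 1
      ≡⟨ *-identityʳ _ ⟩
    miss p q ∎

-- The pairs at distance `d` within the first `d + d` elements are disjoint from each other and from
-- the last `m` elements. The pairs joining the second block to the rest are ignored, which can only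
-- increase the count.
missing-step : ∀ d m → missing (d + (d + m)) d ≤ 3 ^ d * missing m d
missing-step d m = begin
  missing (d + (d + m)) d
    ≡⟨ trans (S-++ d _ _) (S-cong d λ p _ → S-++ d m _) ⟩
  S d (λ p → S d λ q → S m λ r → M (p ++ (q ++ r)))
    ≤⟨ S-mono d (λ p ∣p∣ → S-mono d λ q ∣q∣ → S-mono m λ r _ → step p q r ∣p∣ ∣q∣) ⟩
  S d (λ p → S d λ q → S m λ r → miss p q * M r)
    ≡⟨ S-cong d (λ p _ → trans (S-cong d λ q _ → S-*ˡ m (miss p q) M) (S-*ʳ d (missing m d) (miss p))) ⟩
  S d (λ p → S d (miss p) * missing m d)
    ≡⟨ trans (S-*ʳ d (missing m d) _) (cong (_* missing m d) (S-S-miss d)) ⟩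
  3 ^ d * missing m d ∎
  where
  open ≤-Reasoning
  M : List Bool → ℕ
  M r = miss r (drop d r)
  step : ∀ p q r → length p ≡ d → length q ≡ d → M (p ++ (q ++ r)) ≤ miss p q * M r
  step p q r ∣p∣ ∣q∣ = begin
    M (p ++ (q ++ r))
      ≡⟨ cong (miss (p ++ (q ++ r))) (drop-++ p (q ++ r) ∣p∣) ⟩
    miss (p ++ (q ++ r)) (q ++ r)
      ≡⟨ miss-++ p (q ++ r) q r (trans ∣p∣ (sym ∣q∣)) ⟩
    miss p q * miss (q ++ r) r
      ≡⟨ cong (λ x → miss p q * 𝟙 (not x)) (meet-++ˡ q r r) ⟩
    miss p q * 𝟙 (not (meet q r ∨ meet r (drop (length q) r)))
      ≡⟨ cong (miss p q *_) (𝟙-not-∨ (meet q r) _) ⟩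
    miss p q * (miss q r * miss r (drop (length q) r))
      ≤⟨ *-monoʳ-≤ (miss p q) (*-monoˡ-≤ _ (miss≤1 q r)) ⟩
    miss p q * (1 * miss r (drop (length q) r))
      ≡⟨ cong (miss p q *_) (trans (+-identityʳ _) (cong (λ k → miss r (drop k r)) ∣q∣)) ⟩
    miss p q * M r ∎

4^≡2^2* : ∀ f → 4 ^ f ≡ 2 ^ (f + f)
4^≡2^2* f = trans (^-*-assoc 2 2 f) (cong (2 ^_) (cong (_+_ f) (+-identityʳ f)))

-- The first 2d elements form d disjoint pairs at distance d; strip them while f > d.
missing-bound′ : ∀ k f d m → f ≤ k → 4 ^ f * missing (f + f + m + d) d ≤ 3 ^ f * 2 ^ (f + f + m + d)
missing-bound′ k f d m f≤k with ≤-total f d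
missing-bound′ k f d m f≤k | inj₁ f≤d with m≤n⇒∃[o]m+o≡n f≤d
... | g , refl = begin
  4 ^ f * missing (f + f + m + (f + g)) (f + g)
    ≡⟨ cong (λ N → 4 ^ f * missing N (f + g)) (reorder f g m) ⟩
  4 ^ f * missing (f + (g + (f + (f + m)))) (f + g)
    ≤⟨ *-monoʳ-≤ (4 ^ f) (missing-≤ f g (f + m)) ⟩
  4 ^ f * (3 ^ f * (2 ^ g * 2 ^ (f + m)))
    ≡⟨ lem (4 ^ f) (3 ^ f) (2 ^ g) (2 ^ (f + m)) ⟩
  3 ^ f * (4 ^ f * (2 ^ g * 2 ^ (f + m)))
    ≡⟨ cong (3 ^ f *_) (cong₂ _*_ (4^≡2^2* f) (sym (^-distribˡ-+-* 2 g (f + m)))) ⟩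
  3 ^ f * (2 ^ (f + f) * 2 ^ (g + (f + m)))
    ≡⟨ cong (3 ^ f *_) (trans (sym (^-distribˡ-+-* 2 (f + f) (g + (f + m)))) (cong (2 ^_) (reorder′ f g m))) ⟩
  3 ^ f * 2 ^ (f + f + m + (f + g)) ∎
  where
  open ≤-Reasoning
  reorder : ∀ f g m → f + f + m + (f + g) ≡ f + (g + (f + (f + m)))
  reorder = solve-∀
  reorder′ : ∀ f g m → f + f + (g + (f + m)) ≡ f + f + m + (f + g)
  reorder′ = solve-∀
  lem : ∀ a b c d → a * (b * (c * d)) ≡ b * (a * (c * d))
  lem = solve-∀
-- Stripping 0 elements would not decrease `f`; here only the empty set is counted.
missing-bound′ k f zero m f≤k | inj₂ _ = begin
  4 ^ f * missing (f + f + m + 0) 0  ≡⟨ trans (cong (4 ^ f *_) (missing-0 (f + f + m + 0))) (*-identityʳ _) ⟩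
  4 ^ f                              ≡⟨ 4^≡2^2* f ⟩
  2 ^ (f + f)                        ≤⟨ ^-monoʳ-≤ 2 (≤-trans (m≤m+n (f + f) m) (m≤m+n _ 0)) ⟩
  2 ^ (f + f + m + 0)                ≤⟨ m≤n*m _ (3 ^ f) {{m^n≢0 3 f}} ⟩
  3 ^ f * 2 ^ (f + f + m + 0) ∎
  where open ≤-Reasoning
missing-bound′ k f (suc d′) m f≤k | inj₂ d≤f with m≤n⇒∃[o]m+o≡n d≤f
-- Since `d` is positive, `f` falls from `d + g` to `g`; its bound `k` makes the recursion
-- structural.
missing-bound′ (suc k) _ d@(suc d′) m (s≤s f≤k) | inj₂ _ | g , refl = begin
  4 ^ (d + g) * missing (d + g + (d + g) + m + d) d
    ≡⟨ cong₂ _*_ (^-distribˡ-+-* 4 d g) (cong (λ N → missing N d) (reorder d g m)) ⟩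
  4 ^ d * 4 ^ g * missing (d + (d + (g + g + m + d))) d
    ≤⟨ *-monoʳ-≤ (4 ^ d * 4 ^ g) (missing-step d (g + g + m + d)) ⟩
  4 ^ d * 4 ^ g * (3 ^ d * missing (g + g + m + d) d)
    ≡⟨ lem (4 ^ d) (4 ^ g) (3 ^ d) _ ⟩
  4 ^ d * 3 ^ d * (4 ^ g * missing (g + g + m + d) d)
    ≤⟨ *-monoʳ-≤ (4 ^ d * 3 ^ d) (missing-bound′ k g d m (≤-trans (m≤n+m g d′) f≤k)) ⟩
  4 ^ d * 3 ^ d * (3 ^ g * 2 ^ (g + g + m + d))
    ≡⟨ lem′ (4 ^ d) (3 ^ d) (3 ^ g) _ ⟩
  3 ^ d * 3 ^ g * (4 ^ d * 2 ^ (g + g + m + d))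
    ≡⟨ cong₂ _*_ (sym (^-distribˡ-+-* 3 d g)) (trans (cong (_* 2 ^ (g + g + m + d)) (4^≡2^2* d))
         (trans (sym (^-distribˡ-+-* 2 (d + d) _)) (cong (2 ^_) (reorder′ d g m)))) ⟩
  3 ^ (d + g) * 2 ^ (d + g + (d + g) + m + d) ∎
  where
  open ≤-Reasoning
  reorder : ∀ d g m → d + g + (d + g) + m + d ≡ d + (d + (g + g + m + d))
  reorder = solve-∀
  reorder′ : ∀ d g m → d + d + (g + g + m + d) ≡ d + g + (d + g) + m + d
  reorder′ = solve-∀
  lem : ∀ a b c x → a * b * (c * x) ≡ a * c * (b * x)
  lem = solve-∀
  lem′ : ∀ a b c x → a * b * (c * x) ≡ b * c * (a * x)
  lem′ = solve-∀

missing-bound : ∀ f d {N} → f + f + d ≤ N → 4 ^ f * missing N d ≤ 3 ^ f * 2 ^ N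
missing-bound f d ff+d≤N with m≤n⇒∃[o]m+o≡n ff+d≤N
... | m , refl = subst (λ N → 4 ^ f * missing N d ≤ 3 ^ f * 2 ^ N) (reorder f d m) (missing-bound′ f f d m ≤-refl)
  where
  reorder : ∀ f d m → f + f + m + d ≡ f + f + d + m
  reorder = solve-∀

-- The largest differences, and the cost of ignoring the others.

suf : ℕ → List Bool → List Bool
suf e v = drop (length v ∸ e) v

-- The last j elements of v are paired off with the first j elements of u for
-- every j ≤ k.  If u = v has length N, the pairs are those at distance N − j.
cov : ℕ → List Bool → List Bool → Bool
cov zero    u v = true
cov (suc k) u v = cov k u v ∧ meet u (suf (suc k) v)

length-suf : ∀ {e} v → e ≤ length v → length (suf e v) ≡ e
length-suf {e} v e≤v = trans (length-drop (length v ∸ e) v) (m∸[m∸n]≡n e≤v)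

suf-++ : ∀ {e} u v → e ≤ length v → suf e (u ++ v) ≡ suf e v
suf-++ {e} u v e≤v = begin
  drop (length (u ++ v) ∸ e) (u ++ v)        ≡⟨ cong (λ k → drop (k ∸ e) (u ++ v)) (length-++ u) ⟩
  drop (length u + length v ∸ e) (u ++ v)    ≡⟨ cong (λ k → drop k (u ++ v)) (+-∸-assoc (length u) e≤v) ⟩
  drop (length u + (length v ∸ e)) (u ++ v)  ≡⟨ go u (length v ∸ e) ⟩
  drop (length v ∸ e) v                      ∎
  where
  open ≡-Reasoning
  go : ∀ u k → drop (length u + k) (u ++ v) ≡ drop k v
  go []      k = refl
  go (_ ∷ u) k = go u k

meet-prefix : ∀ u u′ v → length v ≤ length u → meet (u ++ u′) v ≡ meet u v
meet-prefix u u′ v v≤u = begin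
  meet (u ++ u′) v                        ≡⟨ meet-++ˡ u u′ v ⟩
  meet u v ∨ meet u′ (drop (length u) v)  ≡⟨ cong (λ x → meet u v ∨ meet u′ x) (drop-all (length u) v v≤u) ⟩
  meet u v ∨ meet u′ []                   ≡⟨ cong (meet u v ∨_) (meet-[]ʳ u′) ⟩
  meet u v ∨ false                        ≡⟨ ∨-identityʳ _ ⟩
  meet u v                                ∎
  where open ≡-Reasoning

-- Only the first `k` entries of one list and the last `k` of the other are ever compared. This
-- locality makes the two ends of a ruler independent.
cov-++ : ∀ k u u′ v v′ → k ≤ length u → k ≤ length v → cov k (u ++ u′) (v′ ++ v) ≡ cov k u v
cov-++ zero    u u′ v v′ _   _   = refl
cov-++ (suc k) u u′ v v′ k<u k<v = cong₂ _∧_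
  (cov-++ k u u′ v v′ (<⇒≤ k<u) (<⇒≤ k<v))
  (trans (cong (meet (u ++ u′)) (suf-++ v′ v k<v))
         (meet-prefix u u′ _ (≤-trans (≤-reflexive (length-suf v k<v)) k<u)))

V : ℕ → ℕ
V n = S n λ u → S n λ v → 𝟙 (cov n u v)

-- For `k ≤ N`, the subsets of {0,...,N-1} having the `k` largest differences N-1,...,N-k.
covered : ℕ → ℕ → ℕ
covered k N = S N λ r → 𝟙 (cov k r r)

-- The first and the last `h` entries do not overlap, and the `l` entries between them are free.
covered-V : ∀ h l → covered h (h + (l + h)) ≡ V h * 2 ^ l
covered-V h l = begin
  S (h + (l + h)) (λ r → 𝟙 (cov h r r))
    ≡⟨ trans (S-++ h _ _) (S-cong h λ u _ → S-++ l h _) ⟩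
  S h (λ u → S l λ x → S h λ v → 𝟙 (cov h (u ++ (x ++ v)) (u ++ (x ++ v))))
    ≡⟨ S-cong h (λ u ∣u∣ → trans (S-cong l λ x _ → S-cong h λ v ∣v∣ → cong 𝟙 (step u x v ∣u∣ ∣v∣)) (S-const l _)) ⟩
  S h (λ u → 2 ^ l * S h λ v → 𝟙 (cov h u v))
    ≡⟨ trans (S-*ˡ h (2 ^ l) _) (*-comm (2 ^ l) _) ⟩
  V h * 2 ^ l ∎
  where
  open ≡-Reasoning
  step : ∀ u x v → length u ≡ h → length v ≡ h → cov h (u ++ (x ++ v)) (u ++ (x ++ v)) ≡ cov h u v
  step u x v ∣u∣ ∣v∣ = trans
    (cong (cov h (u ++ (x ++ v))) (sym (++-assoc u x v)))
    (cov-++ h u (x ++ v) v (u ++ x) (≤-reflexive (sym ∣u∣)) (≤-reflexive (sym ∣v∣)))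

𝟙-∧-≤ : ∀ a b → 𝟙 (a ∧ b) ≤ 𝟙 a
𝟙-∧-≤ true  true  = ≤-refl
𝟙-∧-≤ true  false = z≤n
𝟙-∧-≤ false b     = ≤-refl

𝟙-≤-∧ : ∀ a b → 𝟙 a ≤ 𝟙 (a ∧ b) + 𝟙 (not b)
𝟙-≤-∧ true  true  = ≤-refl
𝟙-≤-∧ true  false = ≤-refl
𝟙-≤-∧ false b     = z≤n

cov-+-≤ : ∀ o j u v → 𝟙 (cov (o + j) u v) ≤ 𝟙 (cov j u v)
cov-+-≤ zero    j u v = ≤-refl
cov-+-≤ (suc o) j u v = ≤-trans (𝟙-∧-≤ (cov (o + j) u v) _) (cov-+-≤ o j u v)

cov-antitone : ∀ {j k} → j ≤ k → ∀ u v → 𝟙 (cov k u v) ≤ 𝟙 (cov j u v)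
cov-antitone {j} j≤k u v with m≤n⇒∃[o]m+o≡n j≤k
... | o , refl = subst (λ i → 𝟙 (cov i u v) ≤ 𝟙 (cov j u v)) (+-comm o j) (cov-+-≤ o j u v)

covered-antitone : ∀ {j k} → j ≤ k → ∀ N → covered k N ≤ covered j N
covered-antitone j≤k N = S-mono N λ r _ → cov-antitone j≤k r r

-- Union bound: either the next difference occurs, or the subset is counted by `missing`.
covered-suc : ∀ k N → covered k N ≤ covered (suc k) N + missing N (N ∸ suc k)
covered-suc k N = begin
  covered k N
    ≤⟨ S-mono N (λ r _ → 𝟙-≤-∧ (cov k r r) _) ⟩
  S N (λ r → 𝟙 (cov (suc k) r r) + miss r (suf (suc k) r))
    ≡⟨ S-+ N _ _ ⟩
  covered (suc k) N + S N (λ r → miss r (suf (suc k) r))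
    ≡⟨ cong (_+_ (covered (suc k) N)) (S-cong N λ r ∣r∣ → cong (λ n → miss r (drop (n ∸ suc k) r)) ∣r∣) ⟩
  covered (suc k) N + missing N (N ∸ suc k) ∎
  where open ≤-Reasoning

-- Differences are adjoined two at a time with the common exponent `i`, so that the costs form a
-- geometric series of ratio 3/4.
covered-+2 : ∀ i N → i + i ≤ N → 4 ^ i * covered (i + i) N ≤ 4 ^ i * covered (2 + (i + i)) N + 2 * (3 ^ i * 2 ^ N)
covered-+2 i N ii≤N = begin
  4 ^ i * covered (i + i) N
    ≤⟨ *-monoʳ-≤ (4 ^ i) (≤-trans (covered-suc (i + i) N) (+-monoˡ-≤ _ (covered-suc (1 + (i + i)) N))) ⟩
  4 ^ i * (covered (2 + (i + i)) N + missing N d₂ + missing N d₁)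
    ≡⟨ lem (4 ^ i) (covered (2 + (i + i)) N) _ _ ⟩
  4 ^ i * covered (2 + (i + i)) N + (4 ^ i * missing N d₂ + 4 ^ i * missing N d₁)
    ≤⟨ +-monoʳ-≤ (4 ^ i * covered (2 + (i + i)) N) (+-mono-≤ (missing-bound i d₂ (fits (2 + (i + i)) (m≤n+m _ 2)))
                             (missing-bound i d₁ (fits (1 + (i + i)) (m≤n+m _ 1)))) ⟩
  4 ^ i * covered (2 + (i + i)) N + (3 ^ i * 2 ^ N + 3 ^ i * 2 ^ N)
    ≡⟨ cong (λ x → 4 ^ i * covered (2 + (i + i)) N + (3 ^ i * 2 ^ N + x)) (sym (+-identityʳ _)) ⟩
  4 ^ i * covered (2 + (i + i)) N + 2 * (3 ^ i * 2 ^ N) ∎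
  where
  open ≤-Reasoning
  d₁ d₂ : ℕ
  d₁ = N ∸ (1 + (i + i))
  d₂ = N ∸ (2 + (i + i))
  -- `N ∸ k` may be truncated to 0, so the comparison goes through `N ∸ (i + i)`, which is exact.
  fits : ∀ k → i + i ≤ k → i + i + (N ∸ k) ≤ N
  fits k ii≤k = ≤-trans (+-monoʳ-≤ (i + i) (∸-monoʳ-≤ N ii≤k)) (≤-reflexive (m+[n∸m]≡n ii≤N))
  lem : ∀ a x y z → a * (x + y + z) ≡ a * x + (a * y + a * z)
  lem = solve-∀

-- The constant 8 satisfies 2 + (3/4) 8 = 8, where 2 comes from covered-+2.
covered-tail : ∀ t j N → N ≤ (t + j) + (t + j) → 4 ^ j * covered (j + j) N ≤ 4 ^ j * covered N N + 8 * (3 ^ j * 2 ^ N)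
-- The counter `t` reaches 0 only when `N ≤ j + j`, where antitonicity suffices.
covered-tail zero    j N N≤ = ≤-trans (*-monoʳ-≤ (4 ^ j) (covered-antitone N≤ N)) (m≤m+n _ _)
covered-tail (suc t) j N N≤ with ≤-total N (j + j)
... | inj₁ N≤jj = ≤-trans (*-monoʳ-≤ (4 ^ j) (covered-antitone N≤jj N)) (m≤m+n _ _)
... | inj₂ jj≤N = *-cancelˡ-≤ 4 (begin
  4 * (4 ^ j * covered (j + j) N)
    ≤⟨ *-monoʳ-≤ 4 (covered-+2 j N jj≤N) ⟩
  4 * (4 ^ j * covered (2 + (j + j)) N + 2 * (3 ^ j * 2 ^ N))
    ≡⟨ lem₁ (4 ^ j) _ (3 ^ j * 2 ^ N) ⟩
  4 ^ suc j * covered (2 + (j + j)) N + 8 * (3 ^ j * 2 ^ N)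
    ≡⟨ cong (λ k → 4 ^ suc j * covered k N + 8 * (3 ^ j * 2 ^ N)) (sym (cong suc (+-suc j j))) ⟩
  4 ^ suc j * covered (suc j + suc j) N + 8 * (3 ^ j * 2 ^ N)
    ≤⟨ +-monoˡ-≤ _ (covered-tail t (suc j) N (subst (λ k → N ≤ k + k) (sym (+-suc t j)) N≤)) ⟩
  4 ^ suc j * covered N N + 8 * (3 ^ suc j * 2 ^ N) + 8 * (3 ^ j * 2 ^ N)
    ≡⟨ lem₂ (4 ^ j) (covered N N) (3 ^ j) (2 ^ N) ⟩
  4 * (4 ^ j * covered N N + 8 * (3 ^ j * 2 ^ N)) ∎)
  where
  open ≤-Reasoning
  lem₁ : ∀ a x b → 4 * (a * x + 2 * b) ≡ 4 * a * x + 8 * b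
  lem₁ = solve-∀
  lem₂ : ∀ a x b p → 4 * a * x + 8 * (3 * b * p) + 8 * (b * p) ≡ 4 * (a * x + 8 * (b * p))
  lem₂ = solve-∀

-- From lists of numbers to indicator lists.

select : List Bool → List ℕ → List ℕ
select []          _        = []
select (_ ∷ _)     []       = []
select (false ∷ r) (x ∷ xs) = select r xs
select (true ∷ r)  (x ∷ xs) = x ∷ select r xs

length-filter-map : ∀ {P : List ℕ → Set} (P? : Decidable P) (f : List ℕ → List ℕ) xss →
                    length (filter P? (map f xss)) ≡ length (filter (P? ∘ f) xss)
length-filter-map P? f []         = refl
length-filter-map P? f (xs ∷ xss) with does (P? (f xs))
... | true  = cong suc (length-filter-map P? f xss)
... | false = length-filter-map P? f xss

-- `sublists` branches on the head as `S` does: first without it, then with it.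
length-filter-sublists : ∀ {P : List ℕ → Set} (P? : Decidable P) xs →
  length (filter P? (sublists xs)) ≡ S (length xs) λ r → 𝟙 (does (P? (select r xs)))
length-filter-sublists P? [] with does (P? [])
... | true  = refl
... | false = refl
length-filter-sublists P? (x ∷ xs) = begin
  length (filter P? (sublists xs ++ map (x ∷_) (sublists xs)))
    ≡⟨ trans (cong length (filter-++ P? (sublists xs) _)) (length-++ (filter P? (sublists xs))) ⟩
  length (filter P? (sublists xs)) + length (filter P? (map (x ∷_) (sublists xs)))
    ≡⟨ cong₂ _+_ (length-filter-sublists P? xs)
         (trans (length-filter-map P? (x ∷_) (sublists xs)) (length-filter-sublists (P? ∘ (x ∷_)) xs)) ⟩
  S (suc (length xs)) (λ r → 𝟙 (does (P? (select r (x ∷ xs))))) ∎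
  where open ≡-Reasoning

at : List Bool → ℕ → Bool
at []      _       = false
at (b ∷ r) zero    = b
at (b ∷ r) (suc y) = at r y

at-drop : ∀ d r y → at (drop d r) y ≡ at r (d + y)
at-drop zero    r       y = refl
at-drop (suc d) []      y = refl
at-drop (suc d) (x ∷ r) y = at-drop d r y

meet⁻ : ∀ u v → T (meet u v) → ∃ λ y → T (at u y) × T (at v y)
meet⁻ (false ∷ u) (_ ∷ v)     m with meet⁻ u v m
... | y , p = suc y , p
meet⁻ (true ∷ u)  (false ∷ v) m with meet⁻ u v m
... | y , p = suc y , p
meet⁻ (true ∷ u)  (true ∷ v)  m = 0 , tt , tt

meet⁺ : ∀ u v y → T (at u y) → T (at v y) → T (meet u v)
meet⁺ (true ∷ u)  (true ∷ v)  y       p q = tt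
meet⁺ (false ∷ u) (_ ∷ v)     (suc y) p q = meet⁺ u v y p q
meet⁺ (true ∷ u)  (false ∷ v) (suc y) p q = meet⁺ u v y p q

∈-select⁻ : ∀ f n r {x} → x ∈ select r (applyUpTo f n) → ∃ λ y → T (at r y) × x ≡ f y
∈-select⁻ f (suc n) (false ∷ r) x∈ with ∈-select⁻ (f ∘ suc) n r x∈
... | y , p = suc y , p
∈-select⁻ f (suc n) (true ∷ r) (here eq)  = 0 , tt , eq
∈-select⁻ f (suc n) (true ∷ r) (there x∈) with ∈-select⁻ (f ∘ suc) n r x∈
... | y , p = suc y , p

∈-select⁺ : ∀ f r y → T (at r y) → f y ∈ select r (applyUpTo f (length r))
∈-select⁺ f (true ∷ r)  zero    p = here refl
∈-select⁺ f (true ∷ r)  (suc y) p = there (∈-select⁺ (f ∘ suc) r y p)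
∈-select⁺ f (false ∷ r) (suc y) p = ∈-select⁺ (f ∘ suc) r y p

cov⁻ : ∀ k u v → T (cov k u v) → ∀ {j} → j < k → T (meet u (suf (suc j) v))
cov⁻ (suc k) u v c {j} j<1+k with Equivalence.to T-∧ c | m<1+n⇒m<n∨m≡n j<1+k
... | c′ , _ | inj₁ j<k  = cov⁻ k u v c′ j<k
... | _  , m | inj₂ refl = m

cov⁺ : ∀ k u v → (∀ {j} → j < k → T (meet u (suf (suc j) v))) → T (cov k u v)
cov⁺ zero    u v h = tt
cov⁺ (suc k) u v h = Equivalence.from T-∧ (cov⁺ k u v (h ∘ m<n⇒m<1+n) , h ≤-refl)

-- The orders are opposite: the difference `d ≤ n` belongs to `j = n ∸ d`, because keeping the last
-- `suc j` of `suc n` entries shifts the set by `n ∸ j`, which is `d`.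
complete⇔cov : ∀ n r → length r ≡ suc n → Complete n (select r (upTo (suc n))) ⇔ T (cov (suc n) r r)
complete⇔cov n r ∣r∣ = mk⇔ to from
  where
  R : List ℕ
  R = select r (upTo (suc n))
  mem⁺ : ∀ {y} → T (at r y) → y ∈ R
  mem⁺ {y} p = subst (λ N → y ∈ select r (upTo N)) ∣r∣ (∈-select⁺ id r y p)
  mem⁻ : ∀ {y} → y ∈ R → T (at r y)
  mem⁻ y∈ with ∈-select⁻ id (suc n) r y∈
  ... | _ , p , refl = p
  to : Complete n R → T (cov (suc n) r r)
  to c = cov⁺ (suc n) r r λ {j} _ → gap j
    where
    gap : ∀ j → T (meet r (drop (length r ∸ suc j) r))
    gap j with find (applyUpTo⁻ id (suc n) c {n ∸ j} (s≤s (m∸n≤m n j)))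
    ... | y , y∈ , y+d∈ = subst (λ N → T (meet r (drop (N ∸ suc j) r))) (sym ∣r∣)
      (meet⁺ r _ y (mem⁻ y∈) (subst T (sym (trans (at-drop (n ∸ j) r y) (cong (at r) (+-comm (n ∸ j) y)))) (mem⁻ y+d∈)))
  from : T (cov (suc n) r r) → Complete n R
  from c = applyUpTo⁺₁ id (suc n) λ { {d} (s≤s d≤n) → gap d d≤n }
    where
    gap : ∀ d → d ≤ n → _
    gap d d≤n with meet⁻ r _ (cov⁻ (suc n) r r c {n ∸ d} (s≤s (m∸n≤m n d)))
    ... | y , p , q = lose (mem⁺ p) (mem⁺ (subst T eq q))
      where
      eq : at (drop (length r ∸ suc (n ∸ d)) r) y ≡ at r (y + d)
      eq = trans (at-drop _ r y) (cong (at r) (trans (+-comm _ y)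
             (cong (_+_ y) (trans (cong (_∸ suc (n ∸ d)) ∣r∣) (m∸[m∸n]≡n d≤n)))))

a≡covered : ∀ n → a n ≡ covered (suc n) (suc n)
a≡covered n = begin
  a n
    ≡⟨ length-filter-sublists (complete? n) (upTo (suc n)) ⟩
  S (length (upTo (suc n))) (λ r → 𝟙 (does (complete? n (select r (upTo (suc n))))))
    ≡⟨ cong (λ N → S N λ r → 𝟙 (does (complete? n (select r (upTo (suc n)))))) (length-applyUpTo id (suc n)) ⟩
  S (suc n) (λ r → 𝟙 (does (complete? n (select r (upTo (suc n))))))
    ≡⟨ S-cong (suc n) (λ r ∣r∣ → cong 𝟙 (does-⇔ (complete⇔cov n r ∣r∣) (complete? n _) (T? _))) ⟩
  covered (suc n) (suc n) ∎
  where open ≡-Reasoning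

-- Inclusion-exclusion for the upper halves of the two sets.

infixr 6 _∪_
_∪_ : List Bool → List Bool → List Bool
[]      ∪ v       = v
(x ∷ u) ∪ []      = x ∷ u
(x ∷ u) ∪ (y ∷ v) = (x ∨ y) ∷ (u ∪ v)

meet-∪ : ∀ f c v → meet (f ∪ c) v ≡ meet f v ∨ meet c v
meet-∪ []          c           v           = refl
meet-∪ (x ∷ f)     []          v           = sym (trans (∨-comm (meet (x ∷ f) v) false) refl)
meet-∪ (x ∷ f)     (y ∷ c)     []          = refl
meet-∪ (false ∷ f) (false ∷ c) (_ ∷ v)     = meet-∪ f c v
meet-∪ (true ∷ f)  (true ∷ c)  (true ∷ v)  = refl
meet-∪ (true ∷ f)  (true ∷ c)  (false ∷ v) = meet-∪ f c v
meet-∪ (true ∷ f)  (false ∷ c) (true ∷ v)  = refl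
meet-∪ (true ∷ f)  (false ∷ c) (false ∷ v) = meet-∪ f c v
meet-∪ (false ∷ f) (true ∷ c)  (true ∷ v)  = sym (∨-comm (meet f v) true)
meet-∪ (false ∷ f) (true ∷ c)  (false ∷ v) = meet-∪ f c v

hits : List (List Bool) → List Bool → Bool
hits []       v = true
hits (c ∷ cs) v = meet c v ∧ hits cs v

-- Counts the lists of length `n` that miss `f` and hit all of `cs`: those that also miss `c` are
-- taken away. They are among the lists counted first, so `∸` never truncates. The leaves are powers
-- of two, so no sum over the lists is run.
ie : ℕ → List Bool → List (List Bool) → ℕ
ie n f []       = w n f
ie n f (c ∷ cs) = ie n f cs ∸ ie n (f ∪ c) cs

ie-correct : ∀ n f cs → ie n f cs ≡ S n λ v → miss f v * 𝟙 (hits cs v)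
ie-correct n f []       = sym (trans (S-cong n λ v _ → *-identityʳ (miss f v)) (S-miss n f))
ie-correct n f (c ∷ cs) = begin
  ie n f cs ∸ ie n (f ∪ c) cs
    ≡⟨ cong₂ _∸_ (ie-correct n f cs) (ie-correct n (f ∪ c) cs) ⟩
  S n (λ v → miss f v * 𝟙 (hits cs v)) ∸ S n without
    ≡⟨ cong (_∸ S n without) (trans (S-cong n λ v _ → split v) (S-+ n _ without)) ⟩
  S n (λ v → miss f v * 𝟙 (hits (c ∷ cs) v)) + S n without ∸ S n without
    ≡⟨ m+n∸n≡m _ (S n without) ⟩
  S n (λ v → miss f v * 𝟙 (hits (c ∷ cs) v)) ∎
  where
  open ≡-Reasoning
  without : List Bool → ℕ
  without v = miss (f ∪ c) v * 𝟙 (hits cs v)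
  cases : ∀ x y z → 𝟙 (not x) * 𝟙 z ≡ 𝟙 (not x) * 𝟙 (y ∧ z) + 𝟙 (not (x ∨ y)) * 𝟙 z
  cases true  y     z = refl
  cases false true  z = sym (+-identityʳ _)
  cases false false z = refl
  split : ∀ v → miss f v * 𝟙 (hits cs v) ≡ miss f v * 𝟙 (hits (c ∷ cs) v) + without v
  split v = trans (cases (meet f v) (meet c v) (hits cs v))
    (cong (λ x → miss f v * 𝟙 (hits (c ∷ cs) v) + 𝟙 (not x) * 𝟙 (hits cs v)) (sym (meet-∪ f c v)))

-- A and B are the first and last m elements of lists A ++ X and Y ++ B of
-- length 2m.  If the last m + s elements of Y ++ B do not meet A ++ X within
-- A and B alone, they meet it iff Y ++ X meets cube m s A B.
cube : ℕ → ℕ → List Bool → List Bool → List Bool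
cube m s A B = take m (replicate (m ∸ s) false ++ A) ++ suf s B

-- The conditions remaining for the sums m,...,m+t-1. A sum already hit by `A` and `B` leaves none,
-- and each one left out halves the recursion tree of `ie`.
cubes : ℕ → ℕ → List Bool → List Bool → List (List Bool)
cubes m zero    A B = []
cubes m (suc t) A B =
  if meet (drop (suc t) A) B then cubes m t A B else cube m (suc t) A B ∷ cubes m t A B

meet-replicate : ∀ k v → meet (replicate k false) v ≡ false
meet-replicate zero    v       = refl
meet-replicate (suc k) []      = refl
meet-replicate (suc k) (_ ∷ v) = meet-replicate k v

drop-+-++ : ∀ {n} k (u v : List Bool) → length u ≡ n → drop (n + k) (u ++ v) ≡ drop k v
drop-+-++ k []      v refl = refl
drop-+-++ k (_ ∷ u) v refl = drop-+-++ k u v refl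

-- Put `Y′` for the last `s` entries of `Y`. As `s ≤ m`, the block `X` lies beyond `Y′` and never
-- faces it. What remains is `A` against `Y′`, `drop s A` against `B`, and `X` against `suf s B`;
-- the first and the last form the cube.
meet-cube : ∀ {m} s A X Y B → s ≤ m → length A ≡ m → length X ≡ m → length Y ≡ m → length B ≡ m →
  meet (A ++ X) (suf (s + m) (Y ++ B)) ≡ meet (drop s A) B ∨ meet (cube m s A B) (Y ++ X)
meet-cube {m} s A X Y B s≤m ∣A∣ ∣X∣ ∣Y∣ ∣B∣ = begin
  meet (A ++ X) (suf (s + m) (Y ++ B))
    ≡⟨ cong (meet (A ++ X)) tail-eq ⟩
  meet (A ++ X) (Y′ ++ B)
    ≡⟨ meet-++ˡ A X (Y′ ++ B) ⟩
  meet A (Y′ ++ B) ∨ meet X (drop (length A) (Y′ ++ B))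
    ≡⟨ cong₂ _∨_ (meet-++ʳ A Y′ B) (cong (meet X) drop-eq) ⟩
  (meet A Y′ ∨ meet (drop (length Y′) A) B) ∨ meet X (suf s B)
    ≡⟨ cong₂ (λ k x → (meet A Y′ ∨ meet (drop k A) B) ∨ x) ∣Y′∣ (meet-comm X (suf s B)) ⟩
  (meet A Y′ ∨ meet (drop s A) B) ∨ meet (suf s B) X
    ≡⟨ trans (cong (_∨ meet (suf s B) X) (∨-comm (meet A Y′) _)) (∨-assoc (meet (drop s A) B) _ _) ⟩
  meet (drop s A) B ∨ (meet A Y′ ∨ meet (suf s B) X)
    ≡⟨ cong (meet (drop s A) B ∨_) (sym cube-eq) ⟩
  meet (drop s A) B ∨ meet (cube m s A B) (Y ++ X) ∎
  where
  open ≡-Reasoning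
  pad Y′ : List Bool
  pad = replicate (m ∸ s) false
  Y′  = drop (m ∸ s) Y
  tail-eq : suf (s + m) (Y ++ B) ≡ Y′ ++ B
  tail-eq = trans
    (cong (λ k → drop k (Y ++ B)) (trans (cong (_∸ (s + m)) (trans (length-++ Y) (cong₂ _+_ ∣Y∣ ∣B∣)))
      (trans (cong (m + m ∸_) (+-comm s m)) ([m+n]∸[m+o]≡n∸o m m s))))
    (drop-++-≤ (m ∸ s) Y B (≤-trans (m∸n≤m m s) (≤-reflexive (sym ∣Y∣))))
  ∣Y′∣ : length Y′ ≡ s
  ∣Y′∣ = trans (cong (λ k → length (drop (k ∸ s) Y)) (sym ∣Y∣)) (length-suf Y (≤-trans s≤m (≤-reflexive (sym ∣Y∣))))
  drop-eq : drop (length A) (Y′ ++ B) ≡ suf s B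
  drop-eq = trans
    (cong (λ k → drop k (Y′ ++ B)) (trans ∣A∣ (sym (m+[n∸m]≡n s≤m))))
    (trans (drop-+-++ (m ∸ s) Y′ B ∣Y′∣) (cong (λ k → drop (k ∸ s) B) (sym ∣B∣)))
  ∣take∣ : length (take m (pad ++ A)) ≡ m
  ∣take∣ = trans (length-take m (pad ++ A)) (m≤n⇒m⊓n≡m
    (≤-trans (≤-reflexive (sym ∣A∣)) (≤-trans (m≤n+m (length A) (length pad)) (≤-reflexive (sym (length-++ pad))))))
  take-eq : meet (take m (pad ++ A)) Y ≡ meet A Y′
  take-eq = begin
    meet (take m (pad ++ A)) Y
      ≡⟨ sym (meet-prefix (take m (pad ++ A)) (drop m (pad ++ A)) Y (≤-reflexive (trans ∣Y∣ (sym ∣take∣)))) ⟩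
    meet (take m (pad ++ A) ++ drop m (pad ++ A)) Y
      ≡⟨ cong (λ x → meet x Y) (take++drop≡id m (pad ++ A)) ⟩
    meet (pad ++ A) Y
      ≡⟨ meet-++ˡ pad A Y ⟩
    meet pad Y ∨ meet A (drop (length pad) Y)
      ≡⟨ cong₂ (λ x k → x ∨ meet A (drop k Y)) (meet-replicate (m ∸ s) Y) (length-replicate (m ∸ s)) ⟩
    meet A Y′ ∎
  cube-eq : meet (cube m s A B) (Y ++ X) ≡ meet A Y′ ∨ meet (suf s B) X
  cube-eq = trans (meet-++ (take m (pad ++ A)) (suf s B) Y X (trans ∣take∣ (sym ∣Y∣)))
                  (cong (_∨ meet (suf s B) X) take-eq)

cov-cubes : ∀ {m} t A X Y B → t ≤ m → length A ≡ m → length X ≡ m → length Y ≡ m → length B ≡ m →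
  cov (t + m) (A ++ X) (Y ++ B) ≡ cov m A B ∧ hits (cubes m t A B) (Y ++ X)
cov-cubes {m} zero A X Y B _ ∣A∣ _ _ ∣B∣ = trans
  (cov-++ m A X B Y (≤-reflexive (sym ∣A∣)) (≤-reflexive (sym ∣B∣)))
  (sym (∧-identityʳ _))
cov-cubes {m} (suc t) A X Y B t<m ∣A∣ ∣X∣ ∣Y∣ ∣B∣
  rewrite meet-cube (suc t) A X Y B t<m ∣A∣ ∣X∣ ∣Y∣ ∣B∣
        | cov-cubes t A X Y B (<⇒≤ t<m) ∣A∣ ∣X∣ ∣Y∣ ∣B∣
  with meet (drop (suc t) A) B
... | true  = ∧-identityʳ _
... | false = trans (∧-assoc (cov m A B) _ _) (cong (cov m A B ∧_) (∧-comm (hits (cubes m t A B) (Y ++ X)) _))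

opaque
  -- Opaque, so that the sum over 4⁸ pairs is evaluated only where its value is asked for.
  V-ie : ℕ → ℕ
  V-ie m = S m λ A → S m λ B → if cov m A B then ie (m + m) [] (cubes m m A B) else 0

S-rotate : ∀ a b c (F : List Bool → List Bool → List Bool → ℕ) →
  S a (λ x → S b λ y → S c λ z → F x y z) ≡ S c λ z → S a λ x → S b λ y → F x y z
S-rotate a b c F = trans (S-cong a λ x _ → S-swap b c (F x)) (S-swap a c λ x z → S b λ y → F x y z)

opaque
  unfolding V-ie

  -- The second list runs backwards, so `A` and `B` are the lower halves of the two sets. They are
  -- summed over outermost; the upper halves then enter through `hits` alone.
  V-+ : ∀ m → V (m + m) ≡ V-ie m
  V-+ m = begin
    V (m + m)
      ≡⟨ trans (S-++ m m _) (S-cong m λ A _ → S-cong m λ X _ → S-++ m m _) ⟩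
    S m (λ A → S m λ X → S m λ Y → S m λ B → 𝟙 (cov (m + m) (A ++ X) (Y ++ B)))
      ≡⟨ S-cong m (λ A ∣A∣ → S-cong m λ X ∣X∣ → S-cong m λ Y ∣Y∣ → S-cong m λ B ∣B∣ →
           cong 𝟙 (cov-cubes m A X Y B ≤-refl ∣A∣ ∣X∣ ∣Y∣ ∣B∣)) ⟩
    S m (λ A → S m λ X → S m λ Y → S m λ B → G A B (Y ++ X))
      ≡⟨ S-cong m (λ A _ → trans (S-rotate m m m λ X Y B → G A B (Y ++ X))
           (S-cong m λ B _ → trans (S-swap m m λ X Y → G A B (Y ++ X)) (sym (S-++ m m (G A B))))) ⟩
    S m (λ A → S m λ B → S (m + m) (G A B))
      ≡⟨ S-cong m (λ A _ → S-cong m λ B _ → guard (cov m A B) (cubes m m A B)) ⟩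
    V-ie m ∎
    where
    open ≡-Reasoning
    G : List Bool → List Bool → List Bool → ℕ
    G A B v = 𝟙 (cov m A B ∧ hits (cubes m m A B) v)
    guard : ∀ b cs → S (m + m) (λ v → 𝟙 (b ∧ hits cs v)) ≡ (if b then ie (m + m) [] cs else 0)
    guard false cs = trans (S-const (m + m) 0) (*-zeroʳ (2 ^ (m + m)))
    guard true  cs = sym (trans (ie-correct (m + m) [] cs) (S-cong (m + m) λ v _ → +-identityʳ _))

-- Lower bound for `V` by estimating the later sums.

opaque
  -- 4^(2m) times the probability that the sums below m are hit and that the
  -- 2m pairs with exactly one element among the given m do not hit a fixed
  -- later sum.
  tailWeight : ℕ → ℕ
  tailWeight m = S m λ A → S m λ B → if cov m A B then w m A * w m B else 0

S-S-* : ∀ a b c (p q : List Bool → ℕ) → S a (λ x → S b λ y → c * (p x * q y)) ≡ c * (S a p * S b q)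
S-S-* a b c p q = begin
  S a (λ x → S b λ y → c * (p x * q y))
    ≡⟨ S-cong a (λ x _ → trans (S-*ˡ b c _) (cong (c *_) (S-*ˡ b (p x) q))) ⟩
  S a (λ x → c * (p x * S b q))
    ≡⟨ trans (S-*ˡ a c _) (cong (c *_) (S-*ʳ a (S b q) p)) ⟩
  c * (S a p * S b q) ∎
  where open ≡-Reasoning

S-S-+ : ∀ n (F G : List Bool → List Bool → ℕ) →
  S n (λ u → S n λ v → F u v + G u v) ≡ S n (λ u → S n (F u)) + S n (λ u → S n (G u))
S-S-+ n F G = trans (S-cong n λ u _ → S-+ n (F u) (G u)) (S-+ n (λ u → S n (F u)) (λ u → S n (G u)))

-- Sums below `H` do not see the top element of either set, which stands last in `u` and first in
-- `v`; it leaves four choices.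
V-suc : ∀ H → S (suc H) (λ u → S (suc H) λ v → 𝟙 (cov H u v)) ≡ 4 * V H
V-suc H = begin
  S (suc H) (λ u → S (suc H) λ v → 𝟙 (cov H u v))
    ≡⟨ cong (λ n → S n λ u → S (suc H) λ v → 𝟙 (cov H u v)) (+-comm 1 H) ⟩
  S (H + 1) (λ u → S (suc H) λ v → 𝟙 (cov H u v))
    ≡⟨ S-++ H 1 _ ⟩
  S H (λ u → S 1 λ x → S 1 λ y → S H λ v → 𝟙 (cov H (u ++ x) (y ++ v)))
    ≡⟨ S-cong H (λ u ∣u∣ → trans (S-cong 1 λ x _ → S-cong 1 λ y _ → S-cong H λ v ∣v∣ →
         cong 𝟙 (cov-++ H u x v y (≤-reflexive (sym ∣u∣)) (≤-reflexive (sym ∣v∣)))) (lem (S H λ v → 𝟙 (cov H u v)))) ⟩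
  S H (λ u → 4 * S H λ v → 𝟙 (cov H u v))
    ≡⟨ S-*ˡ H 4 _ ⟩
  4 * V H ∎
  where
  open ≡-Reasoning
  lem : ∀ x → (x + x) + (x + x) ≡ 4 * x
  lem = solve-∀

opaque
  unfolding tailWeight

  -- `cov m` sees only the outer blocks `A` and `B`, which do not face each other: the pairings are
  -- `A` with `Y`, `G` with `G′` and `X` with `B`. For fixed `A`, `B` they contribute `w m A`,
  -- `3 ^ g` and `w m B`.
  missing-last : ∀ m g → S (m + (g + m)) (λ u → S (m + (g + m)) λ v → 𝟙 (cov m u v) * miss u v) ≡ tailWeight m * 3 ^ g
  missing-last m g = begin
    S (m + (g + m)) (λ u → S (m + (g + m)) λ v → 𝟙 (cov m u v) * miss u v)
      ≡⟨ trans (split _) (S-cong m λ A _ → S-cong g λ G _ → S-cong m λ X _ → split _) ⟩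
    S m (λ A → S g λ G → S m λ X → S m λ Y → S g λ G′ → S m λ B → F A G X Y G′ B)
      ≡⟨ S-cong m (λ A ∣A∣ → S-cong g λ G ∣G∣ → S-cong m λ X ∣X∣ → S-cong m λ Y ∣Y∣ → S-cong g λ G′ ∣G′∣ → S-cong m λ B ∣B∣ →
           factor A G X Y G′ B ∣A∣ ∣G∣ ∣Y∣ ∣G′∣ ∣B∣) ⟩
    S m (λ A → S g λ G → S m λ X → S m λ Y → S g λ G′ → S m λ B → F′ A G X Y G′ B)
      ≡⟨ S-cong m (λ A _ → trans (S-cong g λ G _ → S-cong m λ X _ → S-rotate m g m λ Y G′ B → F′ A G X Y G′ B)
           (S-rotate g m m λ G X B → S m λ Y → S g λ G′ → F′ A G X Y G′ B)) ⟩
    S m (λ A → S m λ B → S g λ G → S m λ X → S m λ Y → S g λ G′ → F′ A G X Y G′ B)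
      ≡⟨ S-cong m (λ A _ → S-cong m λ B _ → inner A B) ⟩
    S m (λ A → S m λ B → (if cov m A B then w m A * w m B else 0) * 3 ^ g)
      ≡⟨ trans (S-cong m λ A _ → S-*ʳ m (3 ^ g) _) (S-*ʳ m (3 ^ g) _) ⟩
    tailWeight m * 3 ^ g ∎
    where
    open ≡-Reasoning
    F F′ : (A G X Y G′ B : List Bool) → ℕ
    F A G X Y G′ B = 𝟙 (cov m (A ++ (G ++ X)) (Y ++ (G′ ++ B))) * miss (A ++ (G ++ X)) (Y ++ (G′ ++ B))
    F′ A G X Y G′ B = 𝟙 (cov m A B) * (miss A Y * (miss G G′ * miss X B))
    split : ∀ f → S (m + (g + m)) f ≡ S m λ A → S g λ G → S m λ X → f (A ++ (G ++ X))
    split f = trans (S-++ m (g + m) f) (S-cong m λ A _ → S-++ g m _)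
    factor : ∀ A G X Y G′ B → length A ≡ m → length G ≡ g → length Y ≡ m → length G′ ≡ g → length B ≡ m →
             F A G X Y G′ B ≡ F′ A G X Y G′ B
    factor A G X Y G′ B ∣A∣ ∣G∣ ∣Y∣ ∣G′∣ ∣B∣ = cong₂ _*_
      (cong 𝟙 (trans (cong (cov m (A ++ (G ++ X))) (sym (++-assoc Y G′ B)))
         (cov-++ m A (G ++ X) B (Y ++ G′) (≤-reflexive (sym ∣A∣)) (≤-reflexive (sym ∣B∣)))))
      (trans (miss-++ A (G ++ X) Y (G′ ++ B) (trans ∣A∣ (sym ∣Y∣)))
         (cong (miss A Y *_) (miss-++ G X G′ B (trans ∣G∣ (sym ∣G′∣)))))
    guard : ∀ b x y z → 𝟙 b * x * (y * z) ≡ (if b then x * z else 0) * y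
    guard false x y z = refl
    guard true  x y z = lem x y z
      where
      lem : ∀ x y z → (x + 0) * (y * z) ≡ x * z * y
      lem = solve-∀
    S-missˡ : ∀ B → S m (λ X → miss X B) ≡ w m B
    S-missˡ B = trans (S-cong m λ X _ → cong (𝟙 ∘ not) (meet-comm X B)) (S-miss m B)
    inner : ∀ A B → S g (λ G → S m λ X → S m λ Y → S g λ G′ → F′ A G X Y G′ B)
                  ≡ (if cov m A B then w m A * w m B else 0) * 3 ^ g
    inner A B = begin
      S g (λ G → S m λ X → S m λ Y → S g λ G′ → F′ A G X Y G′ B)
        ≡⟨ S-cong g (λ G _ → S-cong m λ X _ → trans (S-S-* m g (𝟙 (cov m A B)) (miss A) (λ G′ → miss G G′ * miss X B))
             (trans (cong₂ (λ x y → 𝟙 (cov m A B) * (x * y)) (S-miss m A) (S-*ʳ g (miss X B) (miss G)))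
                    (sym (*-assoc (𝟙 (cov m A B)) (w m A) _)))) ⟩
      S g (λ G → S m λ X → 𝟙 (cov m A B) * w m A * (S g (miss G) * miss X B))
        ≡⟨ S-S-* g m (𝟙 (cov m A B) * w m A) (λ G → S g (miss G)) (λ X → miss X B) ⟩
      𝟙 (cov m A B) * w m A * (S g (λ G → S g (miss G)) * S m (λ X → miss X B))
        ≡⟨ cong₂ (λ x y → 𝟙 (cov m A B) * w m A * (x * y)) (S-S-miss g) (S-missˡ B) ⟩
      𝟙 (cov m A B) * w m A * (3 ^ g * w m B)
        ≡⟨ guard (cov m A B) (w m A) (3 ^ g) (w m B) ⟩
      (if cov m A B then w m A * w m B else 0) * 3 ^ g ∎

-- Union bound for the new sum `H`. Weakening `cov H` to `cov m` in the error term, instead of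
-- discarding it, keeps the term computable and small.
V-step : ∀ m g → 4 * V (m + (g + m)) ≤ V (m + (suc g + m)) + tailWeight m * 3 ^ suc g
V-step m g = subst (λ K → 4 * V H ≤ V K + tailWeight m * 3 ^ suc g) (sym (+-suc m (g + m))) (begin
  4 * V H
    ≡⟨ sym (V-suc H) ⟩
  S (suc H) (λ u → S (suc H) λ v → 𝟙 (cov H u v))
    ≤⟨ S-mono (suc H) (λ u _ → S-mono (suc H) λ v ∣v∣ → step u v ∣v∣) ⟩
  S (suc H) (λ u → S (suc H) λ v → 𝟙 (cov (suc H) u v) + 𝟙 (cov m u v) * miss u v)
    ≡⟨ S-S-+ (suc H) (λ u v → 𝟙 (cov (suc H) u v)) (λ u v → 𝟙 (cov m u v) * miss u v) ⟩
  V (suc H) + S (suc H) (λ u → S (suc H) λ v → 𝟙 (cov m u v) * miss u v)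
    ≡⟨ cong (λ K → V (suc H) + S K λ u → S K λ v → 𝟙 (cov m u v) * miss u v) (sym (+-suc m (g + m))) ⟩
  V (suc H) + S (m + (suc g + m)) (λ u → S (m + (suc g + m)) λ v → 𝟙 (cov m u v) * miss u v)
    ≡⟨ cong (_+_ (V (suc H))) (missing-last m (suc g)) ⟩
  V (suc H) + tailWeight m * 3 ^ suc g ∎)
  where
  open ≤-Reasoning
  H : ℕ
  H = m + (g + m)
  cases : ∀ a b c → 𝟙 a ≤ 𝟙 c → 𝟙 a ≤ 𝟙 (a ∧ b) + 𝟙 c * 𝟙 (not b)
  cases false b     c     h = z≤n
  cases true  true  c     h = s≤s z≤n
  cases true  false true  h = ≤-refl
  step : ∀ u v → length v ≡ suc H → 𝟙 (cov H u v) ≤ 𝟙 (cov (suc H) u v) + 𝟙 (cov m u v) * miss u v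
  -- At the new sum the suffix compared is all of `v`.
  step u v ∣v∣ = subst (λ x → 𝟙 (cov H u v) ≤ 𝟙 (cov (suc H) u v) + 𝟙 (cov m u v) * miss u x)
    (cong (λ k → drop k v) (trans (cong (_∸ suc H) ∣v∣) (n∸n≡0 (suc H))))
    (cases (cov H u v) _ (cov m u v) (cov-antitone (m≤m+n m (g + m)) u v))

-- Stated with 3 tailWeight (4ʰ − 3ʰ) = Σ_{i<h} 4^(h−1−i) tailWeight 3^(i+1) split
-- over both sides to avoid subtraction.
V-tail : ∀ m h → 4 ^ h * V (m + m) + 3 * tailWeight m * 3 ^ h ≤ V (m + (h + m)) + 3 * tailWeight m * 4 ^ h
V-tail m zero    = ≤-reflexive (cong (_+ 3 * tailWeight m * 1) (*-identityˡ (V (m + m))))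
V-tail m (suc h) = +-cancelʳ-≤ (3 * tailWeight m * 3 ^ h) _ _ (begin
  4 ^ suc h * V (m + m) + 3 * tailWeight m * 3 ^ suc h + 3 * tailWeight m * 3 ^ h
    ≡⟨ lem₁ (4 ^ h) (V (m + m)) (tailWeight m) (3 ^ h) ⟩
  4 * (4 ^ h * V (m + m) + 3 * tailWeight m * 3 ^ h)
    ≤⟨ *-monoʳ-≤ 4 (V-tail m h) ⟩
  4 * (V (m + (h + m)) + 3 * tailWeight m * 4 ^ h)
    ≡⟨ *-distribˡ-+ 4 (V (m + (h + m))) _ ⟩
  4 * V (m + (h + m)) + 4 * (3 * tailWeight m * 4 ^ h)
    ≤⟨ +-monoˡ-≤ _ (V-step m h) ⟩
  V (m + (suc h + m)) + tailWeight m * 3 ^ suc h + 4 * (3 * tailWeight m * 4 ^ h)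
    ≡⟨ lem₂ (V (m + (suc h + m))) (tailWeight m) (3 ^ h) (4 ^ h) ⟩
  V (m + (suc h + m)) + 3 * tailWeight m * 4 ^ suc h + 3 * tailWeight m * 3 ^ h ∎)
  where
  open ≤-Reasoning
  lem₁ : ∀ p v c q → 4 * p * v + 3 * c * (3 * q) + 3 * c * q ≡ 4 * (p * v + 3 * c * q)
  lem₁ = solve-∀
  lem₂ : ∀ v c q p → v + c * (3 * q) + 4 * (3 * c * p) ≡ v + 3 * c * (4 * p) + 3 * c * q
  lem₂ = solve-∀

-- Exact values for m = 8.

opaque
  unfolding V-ie

  V-ie-8 : V-ie 8 ≡ 526027588
  V-ie-8 = refl

opaque
  unfolding tailWeight

  tailWeight-8 : tailWeight 8 ≡ 854069
  tailWeight-8 = refl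

-- Bounds for `a n` in terms of `V`.

2^*4^ : ∀ h l {N} → h + (l + h) ≡ N → 2 ^ l * 4 ^ h ≡ 2 ^ N
2^*4^ h l refl = trans (cong (2 ^ l *_) (4^≡2^2* h))
  (trans (sym (^-distribˡ-+-* 2 l (h + h))) (cong (2 ^_) (reorder h l)))
  where
  reorder : ∀ h l → l + (h + h) ≡ h + (l + h)
  reorder = solve-∀

covered-V-scaled : ∀ h l {N} → h + (l + h) ≡ N → covered h N * 4 ^ h ≡ V h * 2 ^ N
covered-V-scaled h l {N} eq = begin
  covered h N * 4 ^ h      ≡⟨ cong (_* 4 ^ h) (trans (cong (covered h) (sym eq)) (covered-V h l)) ⟩
  V h * 2 ^ l * 4 ^ h      ≡⟨ *-assoc (V h) (2 ^ l) (4 ^ h) ⟩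
  V h * (2 ^ l * 4 ^ h)    ≡⟨ cong (V h *_) (2^*4^ h l eq) ⟩
  V h * 2 ^ N              ∎
  where open ≡-Reasoning

-- Only the `h` largest differences are required. The factor 2 arises because {0,...,n} has `suc n`
-- elements while the scale is `2 ^ n`.
a-upper : ∀ n h → h + h ≤ suc n → a n * 4 ^ h ≤ 2 * V h * 2 ^ n
a-upper n h hh≤N with m≤n⇒∃[o]m+o≡n hh≤N
... | l , eq = begin
  a n * 4 ^ h
    ≡⟨ cong (_* 4 ^ h) (a≡covered n) ⟩
  covered (suc n) (suc n) * 4 ^ h
    ≤⟨ *-monoˡ-≤ (4 ^ h) (covered-antitone (≤-trans (m≤m+n h h) hh≤N) (suc n)) ⟩
  covered h (suc n) * 4 ^ h
    ≡⟨ covered-V-scaled h l (trans (reorder h l) eq) ⟩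
  V h * 2 ^ suc n
    ≡⟨ lem (V h) (2 ^ n) ⟩
  2 * V h * 2 ^ n ∎
  where
  open ≤-Reasoning
  reorder : ∀ h l → h + (l + h) ≡ h + h + l
  reorder = solve-∀
  lem : ∀ v p → v * (2 * p) ≡ 2 * v * p
  lem = solve-∀

-- This is `covered-tail` at `N = suc n`; its 8 doubles for the same reason.
a-lower : ∀ n j → (j + j) + (j + j) ≤ suc n →
  2 * V (j + j) * (2 ^ n * 4 ^ j) ≤ (a n * 4 ^ j + 16 * 3 ^ j * 2 ^ n) * 4 ^ (j + j)
a-lower n j hh≤N with m≤n⇒∃[o]m+o≡n hh≤N
... | l , eq = begin
  2 * V h * (2 ^ n * 4 ^ j)
    ≡⟨ lem₁ (V h) (2 ^ n) (4 ^ j) ⟩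
  4 ^ j * (V h * 2 ^ suc n)
    ≡⟨ cong (4 ^ j *_) (sym (covered-V-scaled h l (trans (reorder h l) eq))) ⟩
  4 ^ j * (covered h (suc n) * 4 ^ h)
    ≡⟨ sym (*-assoc (4 ^ j) _ _) ⟩
  4 ^ j * covered h (suc n) * 4 ^ h
    ≤⟨ *-monoˡ-≤ (4 ^ h) (covered-tail (suc n) j (suc n) (≤-trans (m≤m+n (suc n) j) (m≤m+n (suc n + j) _))) ⟩
  (4 ^ j * covered (suc n) (suc n) + 8 * (3 ^ j * 2 ^ suc n)) * 4 ^ h
    ≡⟨ cong (λ x → (4 ^ j * x + 8 * (3 ^ j * 2 ^ suc n)) * 4 ^ h) (sym (a≡covered n)) ⟩
  (4 ^ j * a n + 8 * (3 ^ j * 2 ^ suc n)) * 4 ^ h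
    ≡⟨ lem₂ (4 ^ j) (a n) (3 ^ j) (2 ^ n) (4 ^ h) ⟩
  (a n * 4 ^ j + 16 * 3 ^ j * 2 ^ n) * 4 ^ h ∎
  where
  open ≤-Reasoning
  h : ℕ
  h = j + j
  reorder : ∀ h l → h + (l + h) ≡ h + h + l
  reorder = solve-∀
  lem₁ : ∀ v p q → 2 * v * (p * q) ≡ q * (v * (2 * p))
  lem₁ = solve-∀
  lem₂ : ∀ q x t p r → (q * x + 8 * (t * (2 * p))) * r ≡ (x * q + 16 * t * p) * r
  lem₂ = solve-∀

-- Passage to rational numbers.

toℚᵘ-/ : ∀ p q → toℚᵘ (+ p / suc q) ℚᵘ.≃ mkℚᵘ (+ p) q
toℚᵘ-/ p q = ℚ.toℚᵘ-fromℚᵘ (mkℚᵘ (+ p) q)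

/-≤ : ∀ p q r s .{{_ : NonZero q}} .{{_ : NonZero s}} → p * s ≤ r * q → + p / q ℚ.≤ + r / s
/-≤ p (suc q) r (suc s) le = ℚ.toℚᵘ-cancel-≤
  (ℚᵘ.≤-respˡ-≃ (ℚᵘ.≃-sym (toℚᵘ-/ p q)) (ℚᵘ.≤-respʳ-≃ (ℚᵘ.≃-sym (toℚᵘ-/ r s))
    (ℚᵘ.*≤* (subst₂ ℤ._≤_ (ℤ.pos-* p (suc s)) (ℤ.pos-* r (suc q)) (ℤ.+≤+ le)))))

/-< : ∀ p q r s .{{_ : NonZero q}} .{{_ : NonZero s}} → p * s < r * q → + p / q ℚ.< + r / s
/-< p (suc q) r (suc s) lt = ℚ.toℚᵘ-cancel-<
  (ℚᵘ.<-respˡ-≃ (ℚᵘ.≃-sym (toℚᵘ-/ p q)) (ℚᵘ.<-respʳ-≃ (ℚᵘ.≃-sym (toℚᵘ-/ r s))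
    (ℚᵘ.*<* (subst₂ ℤ._<_ (ℤ.pos-* p (suc s)) (ℤ.pos-* r (suc q)) (ℤ.+<+ lt)))))

/-+ : ∀ p q r s .{{_ : NonZero q}} .{{_ : NonZero s}} →
      + p / q ℚ.+ + r / s ≡ _/_ (+ (p * s + r * q)) (q * s) {{m*n≢0 q s}}
/-+ p (suc q) r (suc s) = ℚ.toℚᵘ-injective (begin
  toℚᵘ (+ p / suc q ℚ.+ + r / suc s)
    ≈⟨ ℚ.toℚᵘ-homo-+ (+ p / suc q) (+ r / suc s) ⟩
  toℚᵘ (+ p / suc q) ℚᵘ.+ toℚᵘ (+ r / suc s)
    ≈⟨ ℚᵘ.+-cong (toℚᵘ-/ p q) (toℚᵘ-/ r s) ⟩
  mkℚᵘ (+ p ℤ.* + suc s ℤ.+ + r ℤ.* + suc q) (s + q * suc s)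
    ≈⟨ ℚᵘ.≃-reflexive (cong (λ x → mkℚᵘ x (s + q * suc s))
         (sym (trans (ℤ.pos-+ (p * suc s) _) (cong₂ ℤ._+_ (ℤ.pos-* p (suc s)) (ℤ.pos-* r (suc q)))))) ⟩
  mkℚᵘ (+ (p * suc s + r * suc q)) (s + q * suc s)
    ≈⟨ ℚᵘ.≃-sym (toℚᵘ-/ (p * suc s + r * suc q) (s + q * suc s)) ⟩
  toℚᵘ (+ (p * suc s + r * suc q) / (suc q * suc s)) ∎)
  where open import Relation.Binary.Reasoning.Setoid ℚᵘ.≃-setoid

-- The exact count, divided by `2 ^ n`, of rulers having the `h` largest differences, the same for
-- all `n` with `h + h ≤ suc n`.
limit : ℕ → ℚ
limit h = _/_ (+ (2 * V h)) (4 ^ h) {{m^n≢0 4 h}}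

-- Bounds the total cost of all differences beyond the `j + j` largest.
error : ℕ → ℚ
error j = _/_ (+ (16 * 3 ^ j)) (4 ^ j) {{m^n≢0 4 j}}

ratio-upper : ∀ n h → h + h ≤ suc n → ratio n ℚ.≤ limit h
ratio-upper n h hh≤N = /-≤ (a n) (2 ^ n) (2 * V h) (4 ^ h) {{m^n≢0 2 n}} {{m^n≢0 4 h}} (a-upper n h hh≤N)

ratio-lower : ∀ n j → (j + j) + (j + j) ≤ suc n → limit (j + j) ℚ.≤ ratio n ℚ.+ error j
ratio-lower n j hh≤N = subst (limit (j + j) ℚ.≤_)
  (sym (/-+ (a n) (2 ^ n) (16 * 3 ^ j) (4 ^ j) {{m^n≢0 2 n}} {{m^n≢0 4 j}}))
  (/-≤ (2 * V (j + j)) (4 ^ (j + j)) (a n * 4 ^ j + 16 * 3 ^ j * 2 ^ n) (2 ^ n * 4 ^ j)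
    {{m^n≢0 4 (j + j)}} {{m*n≢0 (2 ^ n) (4 ^ j) {{m^n≢0 2 n}} {{m^n≢0 4 j}}}} (a-lower n j hh≤N))

p≤q+r⇒p-q≤r : ∀ {p q r} → p ℚ.≤ q ℚ.+ r → p ℚ.- q ℚ.≤ r
p≤q+r⇒p-q≤r {p} {q} {r} le = ℚ.≤-trans (ℚ.+-monoˡ-≤ (ℚ.- q) le) (ℚ.≤-reflexive (xyx⁻¹≈y ℚ.+-0-abelianGroup q r))

∣p-q∣≤r : ∀ {p q r} → p ℚ.≤ q ℚ.+ r → q ℚ.≤ p ℚ.+ r → ℚ.∣ p ℚ.- q ∣ ℚ.≤ r
∣p-q∣≤r {p} {q} {r} p≤ q≤ with ℚ.∣p∣≡p∨∣p∣≡-p (p ℚ.- q)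
... | inj₁ eq = subst (ℚ._≤ r) (sym eq) (p≤q+r⇒p-q≤r p≤)
... | inj₂ eq = subst (ℚ._≤ r) (sym (trans eq (⁻¹-anti-homo‿- ℚ.+-0-abelianGroup p q))) (p≤q+r⇒p-q≤r q≤)

-- Bernoulli's inequality (1 + 1/3)^j ≥ 1 + j/3, cleared of denominators.
[3+j]*3^j≤3*4^j : ∀ j → (3 + j) * 3 ^ j ≤ 3 * 4 ^ j
[3+j]*3^j≤3*4^j zero    = ≤-refl
[3+j]*3^j≤3*4^j (suc j) = begin
  (4 + j) * (3 * 3 ^ j)            ≤⟨ m≤m+n _ (j * 3 ^ j) ⟩
  (4 + j) * (3 * 3 ^ j) + j * 3 ^ j ≡⟨ lem j (3 ^ j) ⟩
  4 * ((3 + j) * 3 ^ j)            ≤⟨ *-monoʳ-≤ 4 ([3+j]*3^j≤3*4^j j) ⟩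
  4 * (3 * 4 ^ j)                  ≡⟨ lem′ (4 ^ j) ⟩
  3 * 4 ^ suc j                    ∎
  where
  open ≤-Reasoning
  lem : ∀ j x → (4 + j) * (3 * x) + j * x ≡ 4 * ((3 + j) * x)
  lem = solve-∀
  lem′ : ∀ x → 4 * (3 * x) ≡ 3 * (4 * x)
  lem′ = solve-∀

c*3^j<4^j : ∀ c → ∃ λ j → c * 3 ^ j < 4 ^ j
-- This `j` makes 1 + j/3 equal to 1 + c.
c*3^j<4^j c = 3 * c , *-cancelˡ-< 3 _ _ (begin-strict
  3 * (c * 3 ^ j)   ≡⟨ sym (*-assoc 3 c (3 ^ j)) ⟩
  j * 3 ^ j         <⟨ *-monoˡ-< (3 ^ j) {{m^n≢0 3 j}} (m<n+m j {3} (s≤s z≤n)) ⟩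
  (3 + j) * 3 ^ j   ≤⟨ [3+j]*3^j≤3*4^j j ⟩
  3 * 4 ^ j         ∎)
  where
  open ≤-Reasoning
  j : ℕ
  j = 3 * c

error-small : ∀ ε → 0ℚ ℚ.< ε → ∃ λ j → error j ℚ.< ε
error-small (mkℚ (+ zero) _ _) (ℚ.*<* (ℤ.+<+ ()))
error-small (mkℚ ℤ.-[1+ _ ] _ _) (ℚ.*<* ())
-- A positive numerator gives ε ≥ 1/(d+1), so it suffices that 16 (d+1) (3/4)^j < 1.
error-small ε@(mkℚ (+ suc p) d _) _ = map₂ (λ {j} → small j) (c*3^j<4^j (16 * suc d))
  where
  lem : ∀ d x → 16 * d * x ≡ 16 * x * d
  lem = solve-∀
  small : ∀ j → 16 * suc d * 3 ^ j < 4 ^ j → error j ℚ.< ε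
  small j lt = subst (error j ℚ.<_) (ℚ.fromℚᵘ-toℚᵘ ε)
    (/-< (16 * 3 ^ j) (4 ^ j) (suc p) (suc d) {{m^n≢0 4 j}}
      (<-≤-trans (subst (_< 4 ^ j) (lem (suc d) (3 ^ j)) lt) (m≤m+n (4 ^ j) (p * 4 ^ j))))

-- Convergence and the numerical bounds.

-- From some index on, all ratios lie between `limit (j + j)` minus `error j` and `limit (j + j)`.
ratio-Cauchy : Cauchy ratio
ratio-Cauchy ε 0<ε = bound (error-small ε 0<ε)
  where
  close : ∀ j m n → m ≥ (j + j) + (j + j) → n ≥ (j + j) + (j + j) → ratio m ℚ.≤ ratio n ℚ.+ error j
  close j m n m≥N n≥N =
    ℚ.≤-trans (ratio-upper m (j + j) (m≤n⇒m≤1+n m≥N)) (ratio-lower n j (m≤n⇒m≤1+n n≥N))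
  bound : ∃ (λ j → error j ℚ.< ε) → ∃ λ N → ∀ m n → m ≥ N → n ≥ N → ℚ.∣ ratio m ℚ.- ratio n ∣ ℚ.< ε
  bound (j , small) = (j + j) + (j + j) , λ m n m≥N n≥N →
    ℚ.≤-<-trans (∣p-q∣≤r (close j m n m≥N n≥N) (close j n m n≥N m≥N)) small

-- The value of `V-ie m` enters through an equation, so that the comparison to be decided contains
-- numerals only.
limit-below : ∀ m {v} → V-ie m ≡ v → ∀ p q .{{_ : NonZero q}} →
  2 * v * q < p * 4 ^ (m + m) → LimitBelow ratio (+ p / q)
limit-below m refl p q lt = limit (m + m) ,
  /-< (2 * V (m + m)) (4 ^ (m + m)) p q {{m^n≢0 4 (m + m)}}
    (subst (λ v → 2 * v * q < p * 4 ^ (m + m)) (sym (V-+ m)) lt) ,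
  (m + m) + (m + m) , λ n n≥N → ratio-upper n (m + m) (m≤n⇒m≤1+n n≥N)

V-lower : ∀ m h {k v c} → m + (h + m) ≡ k → V-ie m ≡ v → tailWeight m ≡ c → 4 ^ h * v ≤ V k + 3 * c * 4 ^ h
V-lower m h refl refl refl = begin
  4 ^ h * V-ie m                               ≡⟨ cong (4 ^ h *_) (sym (V-+ m)) ⟩
  4 ^ h * V (m + m)                            ≤⟨ m≤m+n _ (3 * tailWeight m * 3 ^ h) ⟩
  4 ^ h * V (m + m) + 3 * tailWeight m * 3 ^ h ≤⟨ V-tail m h ⟩
  V (m + (h + m)) + 3 * tailWeight m * 4 ^ h   ∎
  where open ≤-Reasoning

+-cancelʳ-≤ᵠ : ∀ r {p q} → p ℚ.+ r ℚ.≤ q ℚ.+ r → p ℚ.≤ q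
+-cancelʳ-≤ᵠ r le = ℚ.≮⇒≥ λ q<p → ℚ.<-irrefl refl (ℚ.<-≤-trans (ℚ.+-monoˡ-< r q<p) le)

-- `p / q` plus `error j` is at most `limit (j + j)`, hence at most `ratio n` plus `error j`. The
-- bound `x` replaces `V (j + j)`, which is out of reach of direct evaluation.
ratio-above : ∀ j p q .{{_ : NonZero q}} x → x ≤ V (j + j) →
  (p * 4 ^ j + 16 * 3 ^ j * q) * 4 ^ (j + j) ≤ 2 * x * (q * 4 ^ j) →
  ∀ n → n ≥ (j + j) + (j + j) → + p / q ℚ.≤ ratio n
ratio-above j p q {{q≢0}} x x≤V le n n≥N = +-cancelʳ-≤ᵠ (error j) (ℚ.≤-trans
  (subst (ℚ._≤ limit (j + j)) (sym (/-+ p q (16 * 3 ^ j) (4 ^ j) {{q≢0}} {{m^n≢0 4 j}}))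
    (/-≤ (p * 4 ^ j + 16 * 3 ^ j * q) (q * 4 ^ j) (2 * V (j + j)) (4 ^ (j + j))
      {{m*n≢0 q (4 ^ j) {{q≢0}} {{m^n≢0 4 j}}}} {{m^n≢0 4 (j + j)}}
      (≤-trans le (*-monoˡ-≤ (q * 4 ^ j) (*-monoʳ-≤ 2 x≤V)))))
  (ratio-lower n j (m≤n⇒m≤1+n n≥N)))

-- The condition on `x` says x ≤ v - 3c, so `V-tail` yields `4 ^ h * x ≤ V (j + j)`. The fraction
-- `r / s` is the intermediate rational that `LimitAbove` asks for.
limit-above : ∀ m h j {v c} → m + (h + m) ≡ j + j → V-ie m ≡ v → tailWeight m ≡ c →
  ∀ p q .{{_ : NonZero q}} r s .{{_ : NonZero s}} → p * s < r * q → ∀ x → 4 ^ h * x + 3 * c * 4 ^ h ≤ 4 ^ h * v →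
  (r * 4 ^ j + 16 * 3 ^ j * s) * 4 ^ (j + j) ≤ 2 * (4 ^ h * x) * (s * 4 ^ j) →
  LimitAbove ratio (+ p / q)
limit-above m h j {v} {c} eq V≡v C≡c p q r s lt x x≤ le =
  + r / s , /-< p q r s lt , (j + j) + (j + j) ,
  ratio-above j r s (4 ^ h * x)
    (+-cancelʳ-≤ (3 * c * 4 ^ h) (4 ^ h * x) (V (j + j)) (≤-trans x≤ (V-lower m h eq V≡v C≡c))) le

-- 523465381 = V 16 − 3 tailWeight 8.
theorem1p4 : Cauchy ratio × LimitAbove ratio ((+ 2433) / 10000) × LimitBelow ratio ((+ 2451) / 10000)
theorem1p4 =
  ratio-Cauchy ,
  -- Here 8 + 64 + 8 = 40 + 40. Since 2 · 523465381 / 4¹⁶ > 0.2437 and 16 (3/4)⁴⁰ < 0.0002, the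
  -- intermediate value 0.2434 is safe.
  limit-above 8 64 40 refl V-ie-8 tailWeight-8 2433 10000 2434 10000 (≤ᵇ⇒≤ _ _ tt) 523465381 (≤ᵇ⇒≤ _ _ tt) (≤ᵇ⇒≤ _ _ tt) ,
  -- 2 · 526027588 / 4¹⁶ is about 0.24495.
  limit-below 8 V-ie-8 2451 10000 (≤ᵇ⇒≤ _ _ tt)
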